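{- Let $C\in\mathcal C_1^\star$ be a cluster containing at least two atoms, where $\mathcal C_1^\star$ is a regular atom-respecting clustering. For distinct atoms $A,B\subseteq C$, $$w(A,B)<32\,\frac{d_C(A)\,d_C(B)}{\mathrm{vol}_C}.$$
   Context: Instance: a set $V$ of $n\ge2$ vertices; $\binom V2=E^+\uplus E^-$ (positive/negative pairs, arbitrary); weights $w_{uv}=w_{vu}\ge0$, $w_{uu}=0$, $w_{uv}\le w_{ua}+w_{av}$ for all $u,v,a\in V$. For a partition (clustering) $\mathcal C$ of $V$, $\operatorname{obj}(\mathcal C)$ is the total weight of positive pairs whose endpoints lie in different parts plus the total weight of negative pairs whose endpoints lie in the same part; $\mathrm{OPT}=\min_{\mathcal C}\operatorname{obj}(\mathcal C)$. For $A,B\subseteq V$, $w(A,B)=\sum_{a\in A}\sum_{b\in B}w_{ab}$; $w^+(A,B)$ is the same sum restricted to positive pairs; $w(u,A)=w(\{u\},A)$. $N_u^+=\{v\ne u:uv\in E^+\}$. Atoms. Fix an absolute constant $\beta$ with $0<\beta\le\frac{2\sqrt7-5}{6}$ and a clustering $\mathcal C^0$ with $\operatorname{obj}(\mathcal C^0)\le\frac{20}3\mathrm{OPT}$. For $u\in C\in\mathcal C^0$ put $\delta_C(u)=w(u,N_u^+\triangle C)$ and $M_C=\{u\in C:\delta_C(u)>\frac\beta2w(u,C)\}$. The atom partition $\mathcal K$ is obtained by processing each $C\in\mathcal C^0$: if $\sum_{u\in M_C}\delta_C(u)>\frac{\beta^2}{20}w(C,C)$, put every singleton $\{u\}$, $u\in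 C$, in $\mathcal K$; otherwise put $\{u\}$ in $\mathcal K$ for each $u\in M_C$, and also $C\setminus M_C$ if nonempty. $\alpha\ge1$ is a fixed absolute constant (depending only on $\beta$) such that $\operatorname{obj}(\mathcal K)\le\alpha\,\mathrm{OPT}$ always holds. Regular clustering. Let $\varepsilon\in(0,1]$. For unions $X,Y$ of atoms let $w^+_{\mathcal K}(X,Y)=\sum w^+(K,L)$ over $K,L\in\mathcal K$ with $K\subseteq X$, $L\subseteq Y$, $K\ne L$. $\mathcal C_1^\star$ is a clustering such that each atom is contained in one of its parts (atom-respecting), its cost is at most $(1+\varepsilon)\mathrm{OPT}$, and for each $C\in\mathcal C_1^\star$: (R1) for every partition $S\uplus T=C$ into two nonempty unions of atoms, $w^+(S,T)>\frac12w(S,T)$; (R2) for every atom $K\subsetneq C$, $w^+_{\mathcal K}(K,C)>\frac{\varepsilon}{2\alpha}w^+_{\mathcal K}(K,V)$. For $C\in\mathcal C_1^\star$ with at least two atoms and an atom $K\subseteq C$: $d_C(K)=\sum_{L}w^+(K,L)$ over atoms $L\subseteq C$, $L\ne K$; $\mathrm{vol}_C=\sum_{K\in\mathcal K,\,K\subseteq C}d_C(K)$ (which is positive). -}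

module Defs where

open import Algebra.Bundles using (CommutativeRing)
open import Data.Bool.Base using (Bool; if_then_else_)
import Data.Bool.Properties as Bool
open import Data.Fin.Base using (Fin)
import Data.Fin.Properties as Fin
open import Data.Fin.Subset
  using (Subset; _∈_; _∉_; _⊆_; _⊂_; _∩_; _∪_; _─_; ⊤; ⁅_⁆; ⋃; Nonempty; Empty)
open import Data.Fin.Subset.Properties using (_∈?_; _⊆?_; nonempty?)
open import Data.List.Base as List
  using (List; []; _∷_; _++_; foldr; map; concatMap; filter; allFin)
import Data.List.Membership.Propositional as L
open import Data.List.Relation.Unary.All using (All)
open import Data.List.Relation.Unary.AllPairs using (AllPairs)
open import Data.List.Relation.Unary.Any using (Any; any?)
open import Data.Nat.Base as ℕ using (ℕ)
open import Data.Product.Base using (_×_; ∃-syntax)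
open import Data.Vec.Base using (tabulate)
import Data.Vec.Properties as Vec
open import Level using (Level; _⊔_; suc)
open import Relation.Binary.Core using (Rel)
open import Relation.Binary.Definitions using (DecidableEquality)
open import Relation.Binary.PropositionalEquality.Core using (_≡_)
open import Relation.Binary.Structures using (IsStrictTotalOrder)
import Relation.Binary.Construct.StrictToNonStrict as StrictToNonStrict
open import Relation.Nullary using (¬_; Dec; does; ¬?; _×-dec_)

-- The scalars.  ℝ with its usual order is (classically) an instance.
record OrderedField (c ℓ₁ ℓ₂ : Level) : Set (suc (c ⊔ ℓ₁ ⊔ ℓ₂)) where
  infix  4 _<_
  infix  8 _⁻¹
  infixl 7 _/_
  field
    commutativeRing : CommutativeRing c ℓ₁
  open CommutativeRing commutativeRing public
  field
    -- Total; the value at 0# is unspecified.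
    _⁻¹                : Carrier → Carrier
    ⁻¹-cong            : ∀ {x y} → x ≈ y → x ⁻¹ ≈ y ⁻¹
    ⁻¹-inverseʳ        : ∀ x → ¬ (x ≈ 0#) → x * x ⁻¹ ≈ 1#
    _<_                : Rel Carrier ℓ₂
    isStrictTotalOrder : IsStrictTotalOrder _≈_ _<_
    0<1                : 0# < 1#
    +-monoˡ-<          : ∀ {x y} z → x < y → x + z < y + z
    *-pos              : ∀ {x y} → 0# < x → 0# < y → 0# < x * y

  open IsStrictTotalOrder isStrictTotalOrder public
    using (compare; _<?_; _≟_; <-resp-≈) renaming (trans to <-trans; irrefl to <-irrefl)
  open StrictToNonStrict _≈_ _<_ public using (_≤_)

  _/_ : Carrier → Carrier → Carrier
  x / y = x * y ⁻¹

module CorrelationClustering {c ℓ₁ ℓ₂ : Level} (F : OrderedField c ℓ₁ ℓ₂) where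

  open OrderedField F
  open import Algebra.Properties.CommutativeMonoid.Sum +-commutativeMonoid
    using (sum-syntax)
  open import Algebra.Definitions.RawMonoid +-rawMonoid using () renaming (_×_ to _·_)

  ι : ℕ → Carrier
  ι k = k · 1#

  private variable
    n : ℕ

  ∑∈ : Subset n → (Fin n → Carrier) → Carrier
  ∑∈ {n} A f = ∑[ u < n ] (if does (u ∈? A) then f u else 0#)

  ∑ₗ : {a : Level} {X : Set a} → List X → (X → Carrier) → Carrier
  ∑ₗ xs f = foldr _+_ 0# (map f xs)

  _≟ₛ_ : DecidableEquality (Subset n)
  _≟ₛ_ = Vec.≡-dec Bool._≟_

  elements : Subset n → List (Fin n)
  elements {n} A = filter (_∈? A) (allFin n)

  infixl 6 _△_
  _△_ : Subset n → Subset n → Subset n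
  A △ B = (A ─ B) ∪ (B ─ A)

  -- A clustering is given by the list of its parts; nonemptiness and
  -- pairwise disjointness rule out repetitions in the list.
  record IsPartition (𝒞 : List (Subset n)) : Set where
    field
      nonempty : All Nonempty 𝒞
      disjoint : AllPairs (λ A B → Empty (A ∩ B)) 𝒞
      covers   : ∀ u → Any (u ∈_) 𝒞

  Together : List (Subset n) → Fin n → Fin n → Set
  Together 𝒞 u v = Any (λ C → u ∈ C × v ∈ C) 𝒞

  together? : (𝒞 : List (Subset n)) (u v : Fin n) → Dec (Together 𝒞 u v)
  together? 𝒞 u v = any? (λ C → (u ∈? C) ×-dec (v ∈? C)) 𝒞

  UnionOf : List (Subset n) → Subset n → Set
  UnionOf 𝒦 S = ∃[ Ks ] All (L._∈ 𝒦) Ks × S ≡ ⋃ Ks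

  -- E⁺ is given by its neighbourhoods N⁺ u; the pairs u ≢ v with
  -- v ∉ N⁺ u form E⁻.
  record Instance (n : ℕ) : Set (c ⊔ ℓ₁ ⊔ ℓ₂) where
    field
      N⁺         : Fin n → Subset n
      N⁺-irrefl  : ∀ u → u ∉ N⁺ u
      N⁺-sym     : ∀ {u v} → v ∈ N⁺ u → u ∈ N⁺ v
      w          : Fin n → Fin n → Carrier
      w-sym      : ∀ u v → w u v ≈ w v u
      w-nonneg   : ∀ u v → 0# ≤ w u v
      w-diag     : ∀ u → w u u ≈ 0#
      w-triangle : ∀ u v a → w u v ≤ w u a + w a v

  module _ (I : Instance n) where
    open Instance I

    -- Each unordered pair {u , v} is counted once, as u < v.
    ∑pairs : {P : Fin n → Fin n → Set} → (∀ u v → Dec (P u v)) → Carrier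
    ∑pairs P? = ∑[ u < n ] (∑[ v < n ]
      (if does ((u Fin.<? v) ×-dec P? u v) then w u v else 0#))

    obj : List (Subset n) → Carrier
    obj 𝒞 = ∑pairs (λ u v → (v ∈? N⁺ u) ×-dec ¬? (together? 𝒞 u v))
          + ∑pairs (λ u v → ¬? (v ∈? N⁺ u) ×-dec together? 𝒞 u v)

    IsOPT : Carrier → Set (ℓ₁ ⊔ ℓ₂)
    IsOPT opt = (∃[ 𝒞 ] IsPartition 𝒞 × obj 𝒞 ≈ opt)
              × (∀ 𝒞 → IsPartition 𝒞 → opt ≤ obj 𝒞)

    W W⁺ : Subset n → Subset n → Carrier
    W  A B = ∑∈ A (λ a → ∑∈ B (λ b → w a b))
    W⁺ A B = ∑∈ A (λ a → ∑∈ B (λ b → if does (b ∈? N⁺ a) then w a b else 0#))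

    δ : Subset n → Fin n → Carrier
    δ C u = W ⁅ u ⁆ (N⁺ u △ C)

    M : Carrier → Subset n → Subset n
    M β C = tabulate (λ u →
      does ((u ∈? C) ×-dec ((β / ι 2) * W ⁅ u ⁆ C <? δ C u)))

    atomsOf : Carrier → Subset n → List (Subset n)
    atomsOf β C =
      if does (((β * β) / ι 20) * W C C <? ∑∈ (M β C) (δ C))
      then map ⁅_⁆ (elements C)
      else map ⁅_⁆ (elements (M β C))
           ++ (if does (nonempty? (C ─ M β C)) then (C ─ M β C) ∷ [] else [])

    atoms : Carrier → List (Subset n) → List (Subset n)
    atoms β 𝒞⁰ = concatMap (atomsOf β) 𝒞⁰

    module _ (𝒦 : List (Subset n)) where

      within : Subset n → List (Subset n)
      within X = filter (_⊆? X) 𝒦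

      _without_ : List (Subset n) → Subset n → List (Subset n)
      𝓛 without K = filter (λ L → ¬? (L ≟ₛ K)) 𝓛

      W⁺-atoms : Subset n → Subset n → Carrier
      W⁺-atoms X Y = ∑ₗ (within X) (λ K → ∑ₗ (within Y without K) (λ L → W⁺ K L))

      d : Subset n → Subset n → Carrier
      d C K = ∑ₗ (within C without K) (λ L → W⁺ K L)

      vol : Subset n → Carrier
      vol C = ∑ₗ (within C) (d C)

      record IsRegular (opt ε α : Carrier) (𝒞 : List (Subset n)) : Set (c ⊔ ℓ₁ ⊔ ℓ₂) where
        field
          isPartition : IsPartition 𝒞
          respecting  : ∀ {K} → K L.∈ 𝒦 → Any (K ⊆_) 𝒞
          cost        : obj 𝒞 ≤ (1# + ε) * opt
          R1          : ∀ {C} → C L.∈ 𝒞 → ∀ {S T} →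
                        UnionOf 𝒦 S → UnionOf 𝒦 T → Nonempty S → Nonempty T →
                        S ∪ T ≡ C → Empty (S ∩ T) →
                        (1# / ι 2) * W S T < W⁺ S T
          R2          : ∀ {C} → C L.∈ 𝒞 → ∀ {K} → K L.∈ 𝒦 → K ⊂ C →
                        (ε / (ι 2 * α)) * W⁺-atoms K ⊤ < W⁺-atoms K C

  -- α is an absolute constant: one value for all instances, of all sizes.
  IsAtomConstant : (β α : Carrier) → Set (c ⊔ ℓ₁ ⊔ ℓ₂)
  IsAtomConstant β α =
    ∀ {n} → 2 ℕ.≤ n → (I : Instance n) → ∀ {opt} → IsOPT I opt →
    ∀ {𝒞⁰} → IsPartition 𝒞⁰ → obj I 𝒞⁰ ≤ (ι 20 / ι 3) * opt →
    obj I (atoms I β 𝒞⁰) ≤ α * opt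

{-# OPTIONS --safe #-}
module Submission where

-- Write R = C ∖ (A ∪ B).  Quadruples a ∈ A, b ∈ B, x , y ∈ R satisfy
-- w(a,b) w(x,y) ≤ 4 (w(a,x) w(b,y) + w(a,y) w(b,x)), by the triangle inequality,
-- so summing gives w(A,B) w(R,R) ≤ 8 w(A,R) w(B,R).  The volume of C is at most
-- the total weight of the ordered pairs in C that lie in different atoms, hence
-- at most 2 w(A,B) + 2 w(A,R) + 2 w(B,R) + w(R,R); multiplied by w(A,B), this is
-- at most 8 w(A,C∖A) w(B,C∖B).  Finally (R1) for S = A and T = C∖A gives
-- w(A,C∖A) < 2 d_C(A), and 8 · 2 · 2 = 32.

open import Defs
open import Level using (Level)
open import Data.Nat.Base as ℕ using (ℕ)
open import Data.List.Base using (List; length)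
open import Data.List.Membership.Propositional using () renaming (_∈_ to _∈ₗ_)
open import Data.Fin.Subset using (Subset; _⊆_)
open import Relation.Nullary using (¬_)
open import Relation.Binary.PropositionalEquality.Core using (_≡_)

import Algebra.Properties.CommutativeMonoid.Sum
import Algebra.Properties.Semiring.Sum
import Algebra.Solver.Ring.NaturalCoefficients.Default as Solver
open import Data.Bool.Base using (true; false; if_then_else_)
open import Data.Fin.Base using (Fin; zero; suc)
open import Data.Fin.Subset
  using (inside; outside; _∈_; _∉_; _∩_; _∪_; _─_; ⊥; ⁅_⁆; ⋃; Nonempty; Empty)
open import Data.Fin.Subset.Properties
open import Data.List.Base using ([]; _∷_; _++_; map; concatMap; allFin)
open import Data.List.Membership.Propositional using (find; lose)
import Data.List.Membership.Propositional.Properties as ∈ₗ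
open import Data.List.Relation.Unary.All as All using (All; []; _∷_)
import Data.List.Relation.Unary.All.Properties as All
open import Data.List.Relation.Unary.AllPairs as AllPairs using (AllPairs; []; _∷_)
import Data.List.Relation.Unary.AllPairs.Properties as AllPairs
open import Data.List.Relation.Unary.Any as Any using (Any; here; there)
import Data.List.Relation.Unary.Any.Properties as Any
import Data.List.Relation.Unary.Unique.Propositional.Properties as Unique
open import Data.Product.Base using (∃-syntax; _×_; _,_; proj₁; proj₂)
open import Data.Sum.Base using (_⊎_; inj₁; inj₂; [_,_]′)
open import Data.Vec.Base using (_∷_; there)
import Data.Vec.Properties as Vec
open import Function.Base using (_∘_)
open import Relation.Binary.Bundles using (StrictPartialOrder)
import Relation.Binary.Construct.StrictToNonStrict as StrictToNonStrict
open import Relation.Binary.Definitions using (tri<; tri≈; tri>)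
open import Relation.Binary.PropositionalEquality as ≡ using (_≢_; subst)
import Relation.Binary.Reasoning.StrictPartialOrder
open import Relation.Binary.Structures using (IsStrictTotalOrder)
open import Relation.Nullary using (Dec; yes; no; does; ¬?; contradiction)

-- The product form of the quadruple inequality is essential. Each of a, b, x, y occurs exactly once
-- in every product, so that summation factors into weights between sets and no cardinality appears.
-- A bound on w(x,y) alone, by a detour through A or B, would have to be averaged over that set and
-- would bring in the sizes of A, B and R, about which nothing is known. After multiplication by
-- w(A,B), the term w(R,R) is the only one that needs this inequality: w(A,B) times any of w(A,B),
-- w(A,R), w(B,R) is already a term in the expansion of (w(A,B) + w(A,R)) (w(A,B) + w(B,R)). The
-- result is strict even if w(A,B) = 0, because strictness enters only through (R1). The positivity
-- of the volume has the same source.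

private variable
  n : ℕ

-- Subsets and partitions

x∈p─q⇒x∉q : ∀ (p q : Subset n) {x} → x ∈ p ─ q → x ∉ q
x∈p─q⇒x∉q (s ∷ p) (inside  ∷ q) {zero} ()
x∈p─q⇒x∉q (s ∷ p) (outside ∷ q) {zero} _ ()
x∈p─q⇒x∉q (s ∷ p) (t ∷ q) {suc x} (there i) (there j) =
  x∈p─q⇒x∉q p q i j

⊆-disjoint⇒⊆─ : ∀ {p q r : Subset n} → q ⊆ p → (∀ {x} → x ∈ q → x ∉ r) → q ⊆ p ─ r
⊆-disjoint⇒⊆─ q⊆p q#r x∈q = x∈p∧x∉q⇒x∈p─q (q⊆p x∈q) (q#r x∈q)

Disjoint : Subset n → Subset n → Set
Disjoint A B = Empty (A ∩ B)

Disjoint-⊆ : ∀ {A B C D : Subset n} → A ⊆ C → B ⊆ D → Disjoint C D → Disjoint A B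
Disjoint-⊆ {A = A} {B} A⊆C B⊆D C#D (x , x∈A∩B) =
  let x∈A , x∈B = x∈p∩q⁻ A B x∈A∩B in C#D (x , x∈p∩q⁺ (A⊆C x∈A , B⊆D x∈B))

-- `AllPairs` speaks of positions in the list, so the two membership proofs are compared: at equal
-- positions the sets coincide, at different ones a common vertex is excluded.
AllPairs-Disjoint⇒≡ : ∀ {𝒫 : List (Subset n)} {A B x} → AllPairs Disjoint 𝒫 →
                      A ∈ₗ 𝒫 → B ∈ₗ 𝒫 → x ∈ A → x ∈ B → A ≡ B
AllPairs-Disjoint⇒≡ _          (here ≡.refl) (here ≡.refl) _   _   = ≡.refl
AllPairs-Disjoint⇒≡ (A# ∷ _)  (here ≡.refl) (there B∈)  x∈A x∈B =
  contradiction (_ , x∈p∩q⁺ (x∈A , x∈B)) (All.lookup A# B∈)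
AllPairs-Disjoint⇒≡ (B# ∷ _)  (there A∈)  (here ≡.refl) x∈A x∈B =
  contradiction (_ , x∈p∩q⁺ (x∈B , x∈A)) (All.lookup B# A∈)
AllPairs-Disjoint⇒≡ (_ ∷ 𝒫#) (there A∈)  (there B∈)  x∈A x∈B =
  AllPairs-Disjoint⇒≡ 𝒫# A∈ B∈ x∈A x∈B

-- The relative form of `IsPartition` serves for the atoms cut out of one part of the initial
-- clustering, for the atoms inside C, and for those left when one of them is removed. `included` is
-- new, since inclusion in the whole vertex set is automatic.
record IsPartitionOf (X : Subset n) (𝒫 : List (Subset n)) : Set where
  field
    nonempty : All Nonempty 𝒫
    disjoint : AllPairs Disjoint 𝒫
    included : ∀ {A} → A ∈ₗ 𝒫 → A ⊆ X
    covers   : ∀ {u} → u ∈ X → Any (u ∈_) 𝒫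

∈-⋃⁺ : ∀ {Ls : List (Subset n)} {x} → Any (x ∈_) Ls → x ∈ ⋃ Ls
∈-⋃⁺ {Ls = L ∷ Ls} (here x∈L)  = p⊆p∪q (⋃ Ls) x∈L
∈-⋃⁺ {Ls = L ∷ Ls} (there x∈) = q⊆p∪q L (⋃ Ls) (∈-⋃⁺ x∈)

⋃-⊆ : ∀ {Ls : List (Subset n)} {X} → (∀ {L} → L ∈ₗ Ls → L ⊆ X) → ⋃ Ls ⊆ X
⋃-⊆ {Ls = []}     _   x∈ = contradiction x∈ ∉⊥
⋃-⊆ {Ls = L ∷ Ls} Ls⊆ x∈ with x∈p∪q⁻ L (⋃ Ls) x∈
... | inj₁ x∈L  = Ls⊆ (here ≡.refl) x∈L
... | inj₂ x∈Ls = ⋃-⊆ {Ls = Ls} (λ L∈ → Ls⊆ (there L∈)) x∈Ls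

⋃-≡ : ∀ {X : Subset n} {𝒫} → IsPartitionOf X 𝒫 → X ≡ ⋃ 𝒫
⋃-≡ {𝒫 = 𝒫} P = ⊆-antisym (λ u∈X → ∈-⋃⁺ (covers u∈X)) (⋃-⊆ {Ls = 𝒫} included)
  where open IsPartitionOf P

∪-─-cancel : ∀ {A C : Subset n} → A ⊆ C → A ∪ (C ─ A) ≡ C
∪-─-cancel {A = A} {C} A⊆C = ⊆-antisym
  (λ x∈ → [ A⊆C , p─q⊆p C A ]′ (x∈p∪q⁻ A (C ─ A) x∈)) C⊆
  where
  C⊆ : C ⊆ A ∪ (C ─ A)
  C⊆ {x} x∈C with x ∈? A
  ... | yes x∈A = x∈p∪q⁺ (inj₁ x∈A)
  ... | no  x∉A = x∈p∪q⁺ (inj₂ (x∈p∧x∉q⇒x∈p─q x∈C x∉A))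

-- The atoms partition the vertex set

module _ {c ℓ₁ ℓ₂ : Level} (F : OrderedField c ℓ₁ ℓ₂) where
  open OrderedField F using (Carrier)
  open CorrelationClustering F

  singletons-isPartitionOf : (X : Subset n) → IsPartitionOf X (map ⁅_⁆ (elements X))
  singletons-isPartitionOf {n} X = record
    { nonempty = All.map⁺ (All.tabulate (λ {u} _ → u , x∈⁅x⁆ u))
    ; disjoint = AllPairs.map⁺ (AllPairs.filter⁺ {P = _∈ X} (_∈? X)
        (AllPairs.map ⁅⁆-disjoint (Unique.allFin⁺ n)))
    ; included = λ A∈ → included (∈ₗ.∈-map∘filter⁻ ⁅_⁆ {P = _∈ X} (_∈? X) A∈)
    ; covers   = λ {u} u∈X → lose
        (∈ₗ.∈-map⁺ ⁅_⁆ (∈ₗ.∈-filter⁺ {P = _∈ X} (_∈? X) (∈ₗ.∈-allFin u) u∈X)) (x∈⁅x⁆ u)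
    }
    where
    ⁅⁆-disjoint : ∀ {u v : Fin n} → u ≢ v → Disjoint ⁅ u ⁆ ⁅ v ⁆
    ⁅⁆-disjoint {u} {v} u≢v (x , x∈) = let x∈u , x∈v = x∈p∩q⁻ ⁅ u ⁆ ⁅ v ⁆ x∈ in
      u≢v (≡.trans (≡.sym (x∈⁅y⁆⇒x≡y u x∈u)) (x∈⁅y⁆⇒x≡y v x∈v))

    included : ∀ {A} → ∃[ u ] u ∈ₗ allFin n × A ≡ ⁅ u ⁆ × u ∈ X → A ⊆ X
    included (u , _ , ≡.refl , u∈X) x∈u = subst (_∈ X) (≡.sym (x∈⁅y⁆⇒x≡y u x∈u)) u∈X

  single-isPartitionOf : (X : Subset n) →
    IsPartitionOf X (if does (nonempty? X) then X ∷ [] else [])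
  single-isPartitionOf X with nonempty? X
  ... | yes X≢∅ = record
    { nonempty = X≢∅ ∷ []
    ; disjoint = [] ∷ []
    ; included = λ { (here ≡.refl) → λ x∈ → x∈ }
    ; covers   = here
    }
  ... | no X≡∅ = record
    { nonempty = []
    ; disjoint = []
    ; included = λ ()
    ; covers   = λ u∈X → contradiction (_ , u∈X) X≡∅
    }

  ++-isPartitionOf : ∀ {X Y : Subset n} {𝒫 𝒬} → X ⊆ Y → IsPartitionOf X 𝒫 →
                     IsPartitionOf (Y ─ X) 𝒬 → IsPartitionOf Y (𝒫 ++ 𝒬)
  ++-isPartitionOf {X = X} {Y} {𝒫} {𝒬} X⊆Y P Q = record
    { nonempty = All.++⁺ P.nonempty Q.nonempty
    ; disjoint = AllPairs.++⁺ P.disjoint Q.disjoint (All.tabulate λ A∈ → All.tabulate λ B∈ →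
        Disjoint-⊆ (P.included A∈) (Q.included B∈) X#Y─X)
    ; included = λ {A} A∈ → [ (λ A∈𝒫 x∈ → X⊆Y (P.included A∈𝒫 x∈))
                            , (λ A∈𝒬 x∈ → p─q⊆p Y X (Q.included A∈𝒬 x∈)) ]′ (∈ₗ.∈-++⁻ 𝒫 A∈)
    ; covers   = covers
    }
    where
    module P = IsPartitionOf P
    module Q = IsPartitionOf Q

    X#Y─X : Disjoint X (Y ─ X)
    X#Y─X (x , x∈) = let x∈X , x∈Y─X = x∈p∩q⁻ X (Y ─ X) x∈ in x∈p─q⇒x∉q Y X x∈Y─X x∈X

    covers : ∀ {u} → u ∈ Y → Any (u ∈_) (𝒫 ++ 𝒬)
    covers {u} u∈Y with u ∈? X
    ... | yes u∈X = Any.++⁺ˡ (P.covers u∈X)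
    ... | no  u∉X = Any.++⁺ʳ 𝒫 (Q.covers (x∈p∧x∉q⇒x∈p─q u∈Y u∉X))

  concatMap-isPartition : ∀ {𝒞 : List (Subset n)} {f} → IsPartition 𝒞 →
    (∀ C → IsPartitionOf C (f C)) → IsPartition (concatMap f 𝒞)
  concatMap-isPartition {𝒞 = 𝒞} {f = f} 𝒞-part f-part = record
    { nonempty = All.concat⁺ {xss = map f 𝒞} (All.map⁺ (All.tabulate λ {C} _ → nonempty (f-part C)))
    ; disjoint = AllPairs.concat⁺ {xss = map f 𝒞}
        (All.map⁺ (All.tabulate λ {C} _ → disjoint (f-part C)))
        (AllPairs.map⁺ (AllPairs.map
          (λ {C} {D} C#D → All.tabulate λ A∈ → All.tabulate λ B∈ →
            Disjoint-⊆ (included (f-part C) A∈) (included (f-part D) B∈) C#D)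
          (IsPartition.disjoint 𝒞-part)))
    ; covers   = λ u → Any.concatMap⁺ f {xs = 𝒞}
        (Any.map (λ {C} u∈C → covers (f-part C) u∈C) (IsPartition.covers 𝒞-part u))
    }
    where open IsPartitionOf

  module _ (I : Instance n) (β : Carrier) where

    M⊆ : ∀ C → M I β C ⊆ C
    -- The second scrutinee says that the tabulated bit at u is `inside`; if u lies outside C, this
    -- bit computes to `false`.
    M⊆ C {u} u∈M with u ∈? C | ≡.trans (≡.sym (Vec.lookup∘tabulate _ u)) (Vec.[]=⇒lookup u∈M)
    ... | yes u∈C | _ = u∈C
    ... | no _    | ()

    atomsOf-isPartitionOf : ∀ C → IsPartitionOf C (atomsOf I β C)
    atomsOf-isPartitionOf C with does (((β * β) / ι 20) * W I C C <? ∑∈ (M I β C) (δ I C))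
      where open OrderedField F
    ... | true  = singletons-isPartitionOf C
    ... | false = ++-isPartitionOf (M⊆ C) (singletons-isPartitionOf (M I β C))
                    (single-isPartitionOf (C ─ M I β C))

    atoms-isPartition : ∀ {𝒞⁰} → IsPartition 𝒞⁰ → IsPartition (atoms I β 𝒞⁰)
    atoms-isPartition 𝒞⁰-part = concatMap-isPartition 𝒞⁰-part atomsOf-isPartitionOf

-- Ordered fields and finite sums

module OrderedFieldProperties {c ℓ₁ ℓ₂ : Level} (F : OrderedField c ℓ₁ ℓ₂) where
  open OrderedField F
  open CorrelationClustering F using (ι)

  private module NonStrict = StrictToNonStrict _≈_ _<_

  open IsStrictTotalOrder isStrictTotalOrder public
    using (isStrictPartialOrder; <-respʳ-≈; <-respˡ-≈)

  <-strictPartialOrder : StrictPartialOrder c ℓ₁ ℓ₂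
  <-strictPartialOrder = record { isStrictPartialOrder = isStrictPartialOrder }

  module ≤-Reasoning = Relation.Binary.Reasoning.StrictPartialOrder <-strictPartialOrder
  open ≤-Reasoning

  ≤-refl : ∀ {x} → x ≤ x
  ≤-refl = inj₂ refl

  ≤-total : ∀ x y → x ≤ y ⊎ y ≤ x
  ≤-total = NonStrict.total compare

  ≤-trans : ∀ {x y z} → x ≤ y → y ≤ z → x ≤ z
  ≤-trans = NonStrict.trans isEquivalence <-resp-≈ <-trans

  ≤-<-trans : ∀ {x y z} → x ≤ y → y < z → x < z
  ≤-<-trans = NonStrict.≤-<-trans sym <-trans <-respˡ-≈

  <-≤-trans : ∀ {x y z} → x < y → y ≤ z → x < z
  <-≤-trans = NonStrict.<-≤-trans <-trans <-respʳ-≈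

  +-monoˡ-≤ : ∀ {x y} z → x ≤ y → x + z ≤ y + z
  +-monoˡ-≤ z (inj₁ x<y) = inj₁ (+-monoˡ-< z x<y)
  +-monoˡ-≤ z (inj₂ x≈y) = inj₂ (+-congʳ x≈y)

  +-monoʳ-≤ : ∀ {x y} z → x ≤ y → z + x ≤ z + y
  +-monoʳ-≤ {x} {y} z x≤y = begin
    z + x  ≈⟨ +-comm z x ⟩
    x + z  ≤⟨ +-monoˡ-≤ z x≤y ⟩
    y + z  ≈⟨ +-comm y z ⟩
    z + y  ∎

  +-mono-≤ : ∀ {x y u v} → x ≤ y → u ≤ v → x + u ≤ y + v
  +-mono-≤ x≤y u≤v = ≤-trans (+-monoˡ-≤ _ x≤y) (+-monoʳ-≤ _ u≤v)

  x≤x+y : ∀ {x y} → 0# ≤ y → x ≤ x + y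
  x≤x+y {x} {y} 0≤y = begin
    x       ≈⟨ +-identityʳ x ⟨
    x + 0#  ≤⟨ +-monoʳ-≤ x 0≤y ⟩
    x + y   ∎

  x≤y+x : ∀ {x y} → 0# ≤ y → x ≤ y + x
  x≤y+x {x} {y} 0≤y = ≤-trans (x≤x+y 0≤y) (inj₂ (+-comm x y))

  +-nonneg : ∀ {x y} → 0# ≤ x → 0# ≤ y → 0# ≤ x + y
  +-nonneg 0≤x 0≤y = ≤-trans 0≤x (x≤x+y 0≤y)

  -- The axioms only give positivity of products, so z y is written as z (y - x) + z x with y - x
  -- positive.
  *-monoˡ-<-pos : ∀ {x y} z → 0# < z → x < y → z * x < z * y
  *-monoˡ-<-pos {x} {y} z 0<z x<y = begin-strict
    z * x                  ≈⟨ +-identityˡ _ ⟨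
    0# + z * x             <⟨ +-monoˡ-< (z * x) (*-pos 0<z 0<y-x) ⟩
    z * (y - x) + z * x    ≈⟨ distribˡ z (y - x) x ⟨
    z * (y - x + x)        ≈⟨ *-congˡ (+-assoc y (- x) x) ⟩
    z * (y + (- x + x))    ≈⟨ *-congˡ (+-congˡ (-‿inverseˡ x)) ⟩
    z * (y + 0#)           ≈⟨ *-congˡ (+-identityʳ y) ⟩
    z * y                  ∎
    where
    0<y-x : 0# < y - x
    0<y-x = <-respˡ-≈ (-‿inverseʳ x) (+-monoˡ-< (- x) x<y)

  *-monoʳ-<-pos : ∀ {x y} z → 0# < z → x < y → x * z < y * z
  *-monoʳ-<-pos {x} {y} z 0<z x<y = begin-strict
    x * z  ≈⟨ *-comm x z ⟩
    z * x  <⟨ *-monoˡ-<-pos z 0<z x<y ⟩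
    z * y  ≈⟨ *-comm z y ⟩
    y * z  ∎

  *-monoˡ-≤-nonneg : ∀ {x y} z → 0# ≤ z → x ≤ y → z * x ≤ z * y
  *-monoˡ-≤-nonneg z _ (inj₂ x≈y) = inj₂ (*-congˡ x≈y)
  *-monoˡ-≤-nonneg z (inj₁ 0<z) (inj₁ x<y) = inj₁ (*-monoˡ-<-pos z 0<z x<y)
  *-monoˡ-≤-nonneg {x} {y} z (inj₂ 0≈z) (inj₁ _) = inj₂ (begin-equality
    z * x   ≈⟨ *-congʳ 0≈z ⟨
    0# * x  ≈⟨ zeroˡ x ⟩
    0#      ≈⟨ zeroˡ y ⟨
    0# * y  ≈⟨ *-congʳ 0≈z ⟩
    z * y   ∎)

  *-mono-≤-nonneg : ∀ {x y u v} → 0# ≤ y → 0# ≤ u → x ≤ y → u ≤ v → x * u ≤ y * v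
  *-mono-≤-nonneg {x} {y} {u} {v} 0≤y 0≤u x≤y u≤v = begin
    x * u  ≈⟨ *-comm x u ⟩
    u * x  ≤⟨ *-monoˡ-≤-nonneg u 0≤u x≤y ⟩
    u * y  ≈⟨ *-comm u y ⟩
    y * u  ≤⟨ *-monoˡ-≤-nonneg y 0≤y u≤v ⟩
    y * v  ∎

  -- Since u may vanish, replacing x by y is only a weak step; strictness comes from replacing u by
  -- v, as y > x ≥ 0 makes y positive.
  *-mono-<-nonneg : ∀ {x y u v} → 0# ≤ x → 0# ≤ u → x < y → u < v → x * u < y * v
  *-mono-<-nonneg {x} {y} {u} {v} 0≤x 0≤u x<y u<v = begin-strict
    x * u  ≤⟨ *-mono-≤-nonneg (inj₁ 0<y) 0≤u (inj₁ x<y) ≤-refl ⟩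
    y * u  <⟨ *-monoˡ-<-pos y 0<y u<v ⟩
    y * v  ∎
    where
    0<y : 0# < y
    0<y = ≤-<-trans 0≤x x<y

  *-nonneg : ∀ {x y} → 0# ≤ x → 0# ≤ y → 0# ≤ x * y
  *-nonneg {x} {y} 0≤x 0≤y = ≤-trans (inj₂ (sym (zeroʳ x))) (*-monoˡ-≤-nonneg x 0≤x 0≤y)

  0<x⇒x≉0 : ∀ {x} → 0# < x → ¬ (x ≈ 0#)
  0<x⇒x≉0 0<x x≈0 = <-irrefl (sym x≈0) 0<x

  ⁻¹-pos : ∀ {x} → 0# < x → 0# < x ⁻¹
  ⁻¹-pos {x} 0<x with compare 0# (x ⁻¹)
  ... | tri< 0<x⁻¹ _ _ = 0<x⁻¹
  ... | tri≈ _ 0≈x⁻¹ _ = contradiction 0<1 (<-irrefl (begin-equality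
    0#        ≈⟨ zeroʳ x ⟨
    x * 0#    ≈⟨ *-congˡ 0≈x⁻¹ ⟩
    x * x ⁻¹  ≈⟨ ⁻¹-inverseʳ x (0<x⇒x≉0 0<x) ⟩
    1#        ∎))
  ... | tri> _ _ x⁻¹<0 = contradiction (begin-strict
    0#        <⟨ 0<1 ⟩
    1#        ≈⟨ ⁻¹-inverseʳ x (0<x⇒x≉0 0<x) ⟨
    x * x ⁻¹  <⟨ *-monoˡ-<-pos x 0<x x⁻¹<0 ⟩
    x * 0#    ≈⟨ zeroʳ x ⟩
    0#        ∎) (<-irrefl refl)

  x*z<y⇒x<y/z : ∀ {x y z} → 0# < z → x * z < y → x < y / z
  x*z<y⇒x<y/z {x} {y} {z} 0<z xz<y = begin-strict
    x               ≈⟨ *-identityʳ x ⟨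
    x * 1#          ≈⟨ *-congˡ (⁻¹-inverseʳ z (0<x⇒x≉0 0<z)) ⟨
    x * (z * z ⁻¹)  ≈⟨ *-assoc x z (z ⁻¹) ⟨
    x * z * z ⁻¹    <⟨ *-monoʳ-<-pos (z ⁻¹) (⁻¹-pos 0<z) xz<y ⟩
    y * z ⁻¹        ∎

  [1/z]*x<y⇒x<z*y : ∀ {x y z} → 0# < z → (1# / z) * x < y → x < z * y
  [1/z]*x<y⇒x<z*y {x} {y} {z} 0<z x/z<y = begin-strict
    x                     ≈⟨ *-identityˡ x ⟨
    1# * x                ≈⟨ *-congʳ (⁻¹-inverseʳ z (0<x⇒x≉0 0<z)) ⟨
    (z * z ⁻¹) * x        ≈⟨ *-congʳ (*-congˡ (*-identityˡ (z ⁻¹))) ⟨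
    (z * (1# / z)) * x    ≈⟨ *-assoc z (1# / z) x ⟩
    z * ((1# / z) * x)    <⟨ *-monoˡ-<-pos z 0<z x/z<y ⟩
    z * y                 ∎

  0≤ι : ∀ k → 0# ≤ ι k
  0≤ι ℕ.zero = ≤-refl
  0≤ι (ℕ.suc k) = +-nonneg (inj₁ 0<1) (0≤ι k)

  0<ι1+k : ∀ k → 0# < ι (ℕ.suc k)
  0<ι1+k k = <-≤-trans 0<1 (x≤x+y (0≤ι k))

-- Sums over subsets and over lists

module SumProperties {c ℓ₁ ℓ₂ : Level} (F : OrderedField c ℓ₁ ℓ₂) where
  open OrderedField F hiding (zero)
  open CorrelationClustering F using (∑∈; ∑ₗ)
  open OrderedFieldProperties F
  open ≤-Reasoning
  open Algebra.Properties.CommutativeMonoid.Sum +-commutativeMonoid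
    using (sum; sum-syntax; sum-cong-≋; sum-replicate-zero; ∑-distrib-+; ∑-comm)
  open Algebra.Properties.Semiring.Sum semiring using (*-distribˡ-sum)

  sum-mono-≤ : (f g : Fin n → Carrier) → (∀ i → f i ≤ g i) → sum f ≤ sum g
  sum-mono-≤ {ℕ.zero}  f g f≤g = ≤-refl
  sum-mono-≤ {ℕ.suc n} f g f≤g =
    +-mono-≤ (f≤g zero) (sum-mono-≤ (f ∘ suc) (g ∘ suc) (f≤g ∘ suc))

  if-∑ : ∀ b (f : Fin n → Carrier) →
         (if b then sum f else 0#) ≈ ∑[ i < n ] (if b then f i else 0#)
  if-∑ true  f = refl
  if-∑ {n} false f = sym (sum-replicate-zero n)

  module _ {n} {f g : Fin n → Carrier} where

    ∑∈-mono-≤ : (A : Subset n) → (∀ {u} → u ∈ A → f u ≤ g u) → ∑∈ A f ≤ ∑∈ A g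
    ∑∈-mono-≤ A f≤g = sum-mono-≤ _ _ pointwise
      where
      pointwise : ∀ u → (if does (u ∈? A) then f u else 0#) ≤ (if does (u ∈? A) then g u else 0#)
      pointwise u with u ∈? A
      ... | yes u∈A = f≤g u∈A
      ... | no  _   = ≤-refl

    ∑∈-cong : (A : Subset n) → (∀ {u} → u ∈ A → f u ≈ g u) → ∑∈ A f ≈ ∑∈ A g
    ∑∈-cong A f≈g = sum-cong-≋ {n} pointwise
      where
      pointwise : ∀ u → (if does (u ∈? A) then f u else 0#) ≈ (if does (u ∈? A) then g u else 0#)
      pointwise u with u ∈? A
      ... | yes u∈A = f≈g u∈A
      ... | no  _   = refl

    ∑∈-+ : (A : Subset n) → ∑∈ A (λ u → f u + g u) ≈ ∑∈ A f + ∑∈ A g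
    ∑∈-+ A = trans (sum-cong-≋ {n} pointwise) (∑-distrib-+ {n} _ _)
      where
      pointwise : ∀ u → (if does (u ∈? A) then f u + g u else 0#) ≈
        (if does (u ∈? A) then f u else 0#) + (if does (u ∈? A) then g u else 0#)
      pointwise u with does (u ∈? A)
      ... | true  = refl
      ... | false = sym (+-identityˡ 0#)

  ∑∈-zero : (A : Subset n) → ∑∈ A (λ _ → 0#) ≈ 0#
  ∑∈-zero {n} A = trans (sum-cong-≋ {n} pointwise) (sum-replicate-zero n)
    where
    pointwise : ∀ u → (if does (u ∈? A) then 0# else 0#) ≈ 0#
    pointwise u with does (u ∈? A)
    ... | true  = refl
    ... | false = refl

  ∑∈-*ˡ : ∀ (A : Subset n) x {f} → ∑∈ A (λ u → x * f u) ≈ x * ∑∈ A f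
  ∑∈-*ˡ {n} A x {f} = sym (trans (*-distribˡ-sum {n} x _) (sum-cong-≋ {n} pointwise))
    where
    pointwise : ∀ u → x * (if does (u ∈? A) then f u else 0#) ≈
                      (if does (u ∈? A) then x * f u else 0#)
    pointwise u with does (u ∈? A)
    ... | true  = refl
    ... | false = zeroʳ x

  ∑∈-*ʳ : ∀ (A : Subset n) x {f} → ∑∈ A (λ u → f u * x) ≈ ∑∈ A f * x
  ∑∈-*ʳ A x {f} = begin-equality
    ∑∈ A (λ u → f u * x)  ≈⟨ ∑∈-cong A (λ {u} _ → *-comm (f u) x) ⟩
    ∑∈ A (λ u → x * f u)  ≈⟨ ∑∈-*ˡ A x ⟩
    x * ∑∈ A f            ≈⟨ *-comm x _ ⟩
    ∑∈ A f * x            ∎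

  ∑∈-∑∈-* : ∀ (A B : Subset n) {f g : Fin n → Carrier} →
            ∑∈ A (λ u → ∑∈ B (λ v → f u * g v)) ≈ ∑∈ A f * ∑∈ B g
  ∑∈-∑∈-* A B {f} = trans (∑∈-cong A (λ {u} _ → ∑∈-*ˡ B (f u))) (∑∈-*ʳ A _)

  -- Once the outer guard is pushed inside by `if-∑`, both sums run over all vertices and can be
  -- exchanged; the guards then trade places pointwise.
  ∑∈-comm : ∀ (A B : Subset n) (f : Fin n → Fin n → Carrier) →
            ∑∈ A (λ u → ∑∈ B (f u)) ≈ ∑∈ B (λ v → ∑∈ A (λ u → f u v))
  ∑∈-comm {n} A B f = begin-equality
    ∑∈ A (λ u → ∑∈ B (f u))
      ≈⟨ sum-cong-≋ {n} (λ u → if-∑ {n} (does (u ∈? A)) _) ⟩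
    ∑[ u < n ] (∑[ v < n ] (if does (u ∈? A) then (if does (v ∈? B) then f u v else 0#) else 0#))
      ≈⟨ ∑-comm {n} {n} _ ⟩
    ∑[ v < n ] (∑[ u < n ] (if does (u ∈? A) then (if does (v ∈? B) then f u v else 0#) else 0#))
      ≈⟨ sum-cong-≋ {n} (λ v → sum-cong-≋ {n} (λ u → if-swap (does (u ∈? A)) (does (v ∈? B)))) ⟩
    ∑[ v < n ] (∑[ u < n ] (if does (v ∈? B) then (if does (u ∈? A) then f u v else 0#) else 0#))
      ≈⟨ sum-cong-≋ {n} (λ v → if-∑ {n} (does (v ∈? B)) _) ⟨
    ∑∈ B (λ v → ∑∈ A (λ u → f u v))
      ∎
    where
    if-swap : ∀ a b {x} → (if a then (if b then x else 0#) else 0#) ≈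
                          (if b then (if a then x else 0#) else 0#)
    if-swap true  true  = refl
    if-swap true  false = refl
    if-swap false true  = refl
    if-swap false false = refl

  ∑∈-split : ∀ {n} {A X : Subset n} (f : Fin n → Carrier) → A ⊆ X →
             ∑∈ X f ≈ ∑∈ A f + ∑∈ (X ─ A) f
  ∑∈-split {n} {A} {X} f A⊆X = trans (sum-cong-≋ {n} pointwise) (∑-distrib-+ {n} _ _)
    where
    pointwise : ∀ u → (if does (u ∈? X) then f u else 0#) ≈
      (if does (u ∈? A) then f u else 0#) + (if does (u ∈? X ─ A) then f u else 0#)
    pointwise u with u ∈? X | u ∈? A | u ∈? X ─ A
    ... | yes _   | yes _   | no _    = sym (+-identityʳ _)
    ... | yes _   | no  _   | yes _   = sym (+-identityˡ _)
    ... | no _    | no _    | no _    = sym (+-identityˡ _)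
    ... | _       | yes u∈A | yes u∈X─A = contradiction u∈A (x∈p─q⇒x∉q X A u∈X─A)
    ... | yes u∈X | no u∉A  | no u∉X─A = contradiction (x∈p∧x∉q⇒x∈p─q u∈X u∉A) u∉X─A
    ... | no u∉X  | yes u∈A | _       = contradiction (A⊆X u∈A) u∉X
    ... | no u∉X  | no _    | yes u∈X─A = contradiction (p─q⊆p X A u∈X─A) u∉X

  module _ {n} {f : Fin n → Carrier} (0≤f : ∀ u → 0# ≤ f u) where

    ∑∈-nonneg : (A : Subset n) → 0# ≤ ∑∈ A f
    ∑∈-nonneg A = ≤-trans (inj₂ (sym (∑∈-zero A))) (∑∈-mono-≤ A (λ {u} _ → 0≤f u))

    ∑∈-∪-≤ : (A B : Subset n) → ∑∈ (A ∪ B) f ≤ ∑∈ A f + ∑∈ B f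
    ∑∈-∪-≤ A B = ≤-trans (sum-mono-≤ _ _ pointwise) (inj₂ (∑-distrib-+ {n} _ _))
      where
      pointwise : ∀ u → (if does (u ∈? A ∪ B) then f u else 0#) ≤
        (if does (u ∈? A) then f u else 0#) + (if does (u ∈? B) then f u else 0#)
      pointwise u with u ∈? A ∪ B | u ∈? A | u ∈? B
      ... | yes _ | yes _ | yes _ = x≤x+y (0≤f u)
      ... | yes _ | yes _ | no _  = x≤x+y ≤-refl
      ... | yes _ | no _  | yes _ = x≤y+x ≤-refl
      ... | yes u∈A∪B | no u∉A | no u∉B = contradiction (x∈p∪q⁻ A B u∈A∪B) [ u∉A , u∉B ]′
      -- This combination and the next two cannot occur, but nonnegativity settles them without a
      -- contradiction.
      ... | no _ | yes _ | yes _ = +-nonneg (0≤f u) (0≤f u)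
      ... | no _ | yes _ | no _  = +-nonneg (0≤f u) ≤-refl
      ... | no _ | no _  | yes _ = +-nonneg ≤-refl (0≤f u)
      ... | no _ | no _  | no _  = +-nonneg ≤-refl ≤-refl

    ∑∈-⋃-≤ : (Ls : List (Subset n)) → ∑∈ (⋃ Ls) f ≤ ∑ₗ Ls (λ L → ∑∈ L f)
    ∑∈-⋃-≤ [] = inj₂ (trans
      (∑∈-cong {f = f} {λ _ → 0#} ⊥ (λ u∈⊥ → contradiction u∈⊥ ∉⊥))
      (∑∈-zero {n} ⊥))
    ∑∈-⋃-≤ (L ∷ Ls) = ≤-trans (∑∈-∪-≤ L (⋃ Ls)) (+-monoʳ-≤ _ (∑∈-⋃-≤ Ls))

    -- Induction with X varying: the later sets avoid L, so they lie in `X ─ L`, and the sum over X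
    -- splits at L.
    ∑ₗ-disjoint-≤ : ∀ {Ls : List (Subset n)} {X} → AllPairs Disjoint Ls →
                    All (_⊆ X) Ls → ∑ₗ Ls (λ L → ∑∈ L f) ≤ ∑∈ X f
    ∑ₗ-disjoint-≤ {X = X} [] [] = ∑∈-nonneg X
    ∑ₗ-disjoint-≤ {L ∷ Ls} {X} (L# ∷ Ls#) (L⊆X ∷ Ls⊆X) = begin
      ∑∈ L f + ∑ₗ Ls (λ K → ∑∈ K f)  ≤⟨ +-monoʳ-≤ _ (∑ₗ-disjoint-≤ Ls# Ls⊆X─L) ⟩
      ∑∈ L f + ∑∈ (X ─ L) f          ≈⟨ ∑∈-split f L⊆X ⟨
      ∑∈ X f                         ∎
      where
      K⊆X─L : ∀ {K} → Empty (L ∩ K) × K ⊆ X → K ⊆ X ─ L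
      K⊆X─L (L#K , K⊆X) = ⊆-disjoint⇒⊆─ K⊆X (λ x∈K x∈L → L#K (_ , x∈p∩q⁺ (x∈L , x∈K)))

      Ls⊆X─L : All (_⊆ X ─ L) Ls
      Ls⊆X─L = All.zipWith {R = _⊆ X ─ L} (λ p → K⊆X─L p) (L# , Ls⊆X)

  module _ {a} {X : Set a} {f g : X → Carrier} where

    ∑ₗ-mono-≤ : (xs : List X) → (∀ {x} → x ∈ₗ xs → f x ≤ g x) → ∑ₗ xs f ≤ ∑ₗ xs g
    ∑ₗ-mono-≤ []       f≤g = ≤-refl
    ∑ₗ-mono-≤ (x ∷ xs) f≤g =
      +-mono-≤ (f≤g (here ≡.refl)) (∑ₗ-mono-≤ xs (f≤g ∘ there))

  module _ {a} {X : Set a} {f : X → Carrier} (0≤f : ∀ x → 0# ≤ f x) where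

    ∑ₗ-nonneg : (xs : List X) → 0# ≤ ∑ₗ xs f
    ∑ₗ-nonneg []       = ≤-refl
    ∑ₗ-nonneg (x ∷ xs) = +-nonneg (0≤f x) (∑ₗ-nonneg xs)

    ∈⇒≤∑ₗ : ∀ {x xs} → x ∈ₗ xs → f x ≤ ∑ₗ xs f
    ∈⇒≤∑ₗ {xs = _ ∷ xs} (here ≡.refl) = x≤x+y (∑ₗ-nonneg xs)
    ∈⇒≤∑ₗ {xs = y ∷ _} (there x∈xs)  = ≤-trans (∈⇒≤∑ₗ x∈xs) (x≤y+x (0≤f y))

  ∑∈-∑ₗ : ∀ {a} {X : Set a} (A : Subset n) (xs : List X) (f : X → Fin n → Carrier) →
          ∑ₗ xs (λ x → ∑∈ A (f x)) ≈ ∑∈ A (λ u → ∑ₗ xs (λ x → f x u))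
  ∑∈-∑ₗ A []       f = sym (∑∈-zero A)
  ∑∈-∑ₗ A (x ∷ xs) f = trans (+-congˡ (∑∈-∑ₗ A xs f)) (sym (∑∈-+ A))

-- The volume bound

module _ {c ℓ₁ ℓ₂ : Level} (F : OrderedField c ℓ₁ ℓ₂) where
  open OrderedField F hiding (zero)
  open CorrelationClustering F
  open OrderedFieldProperties F
  open SumProperties F
  open ≤-Reasoning
  open Solver commutativeSemiring using (solve; con; _:=_; _:+_; _:*_; Polynomial)

  private
    -- `con k` denotes a differently bracketed sum of ones than ι k.
    :ι : ∀ {m} → ℕ → Polynomial m
    :ι ℕ.zero    = con 0
    :ι (ℕ.suc k) = con 1 :+ :ι k

  -- The common end of the four cases below: each diagonal is at most twice a side, and the two
  -- sides are opposite, so that their product is one of the two summands of z.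
  *-≤-via-doubles : ∀ {x y z u v} → 0# ≤ v → 0# ≤ x → u ≤ x + x → v ≤ y + y → x * y ≤ z →
                    u * v ≤ ι 4 * z
  *-≤-via-doubles {x} {y} {z} {u} {v} 0≤v 0≤x u≤2x v≤2y xy≤z = begin
    u * v              ≤⟨ *-mono-≤-nonneg (+-nonneg 0≤x 0≤x) 0≤v u≤2x v≤2y ⟩
    (x + x) * (y + y)  ≈⟨ solve 2 (λ x y → (x :+ x) :* (y :+ y) := :ι 4 :* (x :* y)) refl x y ⟩
    ι 4 * (x * y)      ≤⟨ *-monoˡ-≤-nonneg (ι 4) (0≤ι 4) xy≤z ⟩
    ι 4 * z            ∎

  -- The hypotheses are the triangle inequalities in a quadrilateral with
  -- diagonals u, v and opposite sides p, q and s, t.  If p is the shortest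
  -- side, then u ≤ 2t and v ≤ 2s; the other cases are symmetric.
  quadrilateral : ∀ {p q s t u v} → 0# ≤ p → 0# ≤ q → 0# ≤ s → 0# ≤ t → 0# ≤ v →
    u ≤ p + t → u ≤ s + q → v ≤ p + s → v ≤ t + q → u * v ≤ ι 4 * (p * q + s * t)
  quadrilateral {p} {q} {s} {t} {u} {v} 0≤p 0≤q 0≤s 0≤t 0≤v u≤p+t u≤s+q v≤p+s v≤t+q =
    cases (≤-total p s) (≤-total p t) (≤-total q s) (≤-total q t)
    where
    Goal : Set _
    Goal = u * v ≤ ι 4 * (p * q + s * t)

    pq≤ : p * q ≤ p * q + s * t
    pq≤ = x≤x+y (*-nonneg 0≤s 0≤t)

    st≤ : s * t ≤ p * q + s * t
    st≤ = x≤y+x (*-nonneg 0≤p 0≤q)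

    p-least : p ≤ s → p ≤ t → Goal
    p-least p≤s p≤t = *-≤-via-doubles 0≤v 0≤t
      (≤-trans u≤p+t (+-monoˡ-≤ t p≤t)) (≤-trans v≤p+s (+-monoˡ-≤ s p≤s))
      (≤-trans (inj₂ (*-comm t s)) st≤)

    q-least : q ≤ s → q ≤ t → Goal
    q-least q≤s q≤t = *-≤-via-doubles 0≤v 0≤s
      (≤-trans u≤s+q (+-monoʳ-≤ s q≤s)) (≤-trans v≤t+q (+-monoʳ-≤ t q≤t)) st≤

    s-least : s ≤ p → s ≤ q → Goal
    s-least s≤p s≤q = *-≤-via-doubles 0≤v 0≤q
      (≤-trans u≤s+q (+-monoˡ-≤ q s≤q)) (≤-trans v≤p+s (+-monoʳ-≤ p s≤p))
      (≤-trans (inj₂ (*-comm q p)) pq≤)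

    t-least : t ≤ p → t ≤ q → Goal
    t-least t≤p t≤q = *-≤-via-doubles 0≤v 0≤p
      (≤-trans u≤p+t (+-monoʳ-≤ p t≤p)) (≤-trans v≤t+q (+-monoˡ-≤ q t≤q)) pq≤

    cases : p ≤ s ⊎ s ≤ p → p ≤ t ⊎ t ≤ p → q ≤ s ⊎ s ≤ q → q ≤ t ⊎ t ≤ q → Goal
    cases (inj₁ p≤s) (inj₁ p≤t) _          _          = p-least p≤s p≤t
    cases _          _          (inj₁ q≤s) (inj₁ q≤t) = q-least q≤s q≤t
    cases (inj₂ s≤p) _          (inj₂ s≤q) _          = s-least s≤p s≤q
    cases _          (inj₂ t≤p) _          (inj₂ t≤q) = t-least t≤p t≤q
    -- Only adjacent sides are compared. In the two remaining cases the comparisons run in a cycle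
    -- around the quadrilateral, so all sides are equal and any of them can serve as the least.
    cases (inj₁ p≤s) (inj₂ t≤p) (inj₂ s≤q) (inj₁ q≤t) = t-least t≤p (≤-trans t≤p (≤-trans p≤s s≤q))
    cases (inj₂ s≤p) (inj₁ p≤t) (inj₁ q≤s) (inj₂ t≤q) = s-least s≤p (≤-trans s≤p (≤-trans p≤t t≤q))

  -- Weights between sets of vertices

  module _ (I : Instance n) where
    open Instance I

    W-nonneg : ∀ A B → 0# ≤ W I A B
    W-nonneg A B = ∑∈-nonneg (λ a → ∑∈-nonneg (w-nonneg a) B) A

    W-sym : ∀ A B → W I A B ≈ W I B A
    W-sym A B = trans (∑∈-comm A B w) (∑∈-cong B (λ _ → ∑∈-cong A (λ _ → w-sym _ _)))

    -- The quadrilateral has its vertices in the cyclic order a, x, b, y. They may coincide, as they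
    -- do on the diagonal x = y of the double sum over R.
    w-quadrilateral : ∀ a b x y → w a b * w x y ≤ ι 4 * (w a x * w b y + w a y * w b x)
    w-quadrilateral a b x y = quadrilateral
      (w-nonneg a x) (w-nonneg b y) (w-nonneg a y) (w-nonneg b x) (w-nonneg x y)
      (≤-trans (w-triangle a b x) (inj₂ (+-congˡ (w-sym x b))))
      (≤-trans (w-triangle a b y) (inj₂ (+-congˡ (w-sym y b))))
      (≤-trans (w-triangle x y a) (inj₂ (+-congʳ (w-sym x a))))
      (≤-trans (w-triangle x y b) (inj₂ (+-congʳ (w-sym x b))))

    -- Summed over x and y in R, both products of `w-quadrilateral` give w(a,R) w(b,R), the second
    -- after exchanging x and y. Hence 4 + 4 = 8.
    W-quadrilateral : ∀ A B R → W I A B * W I R R ≤ ι 8 * (W I A R * W I B R)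
    W-quadrilateral A B R = begin
      W I A B * W I R R
        ≈⟨ ∑∈-*ʳ A (W I R R) ⟨
      ∑∈ A (λ a → ∑∈ B (w a) * W I R R)
        ≈⟨ ∑∈-cong A (λ _ → ∑∈-*ʳ B (W I R R)) ⟨
      ∑∈ A (λ a → ∑∈ B (λ b → w a b * W I R R))
        ≤⟨ ∑∈-mono-≤ A (λ {a} _ → ∑∈-mono-≤ B (λ {b} _ → bound a b)) ⟩
      ∑∈ A (λ a → ∑∈ B (λ b → ι 8 * (w[ a ] * w[ b ])))
        ≈⟨ ∑∈-cong A (λ _ → ∑∈-*ˡ B (ι 8)) ⟩
      ∑∈ A (λ a → ι 8 * ∑∈ B (λ b → w[ a ] * w[ b ]))
        ≈⟨ ∑∈-*ˡ A (ι 8) ⟩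
      ι 8 * ∑∈ A (λ a → ∑∈ B (λ b → w[ a ] * w[ b ]))
        ≈⟨ *-congˡ (∑∈-∑∈-* A B) ⟩
      ι 8 * (W I A R * W I B R)
        ∎
      where
      w[_] : Fin n → Carrier
      w[ u ] = ∑∈ R (w u)

      bound : ∀ a b → w a b * W I R R ≤ ι 8 * (w[ a ] * w[ b ])
      bound a b = begin
        w a b * W I R R
          ≈⟨ ∑∈-*ˡ R (w a b) ⟨
        ∑∈ R (λ x → w a b * ∑∈ R (w x))
          ≈⟨ ∑∈-cong R (λ _ → ∑∈-*ˡ R (w a b)) ⟨
        ∑∈ R (λ x → ∑∈ R (λ y → w a b * w x y))
          ≤⟨ ∑∈-mono-≤ R (λ {x} _ → ∑∈-mono-≤ R (λ {y} _ → w-quadrilateral a b x y)) ⟩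
        ∑∈ R (λ x → ∑∈ R (λ y → ι 4 * (w a x * w b y + w a y * w b x)))
          ≈⟨ ∑∈-cong R (λ _ → trans (∑∈-*ˡ R (ι 4)) (*-congˡ (∑∈-+ R))) ⟩
        ∑∈ R (λ x → ι 4 * (∑∈ R (λ y → w a x * w b y) + ∑∈ R (λ y → w a y * w b x)))
          ≈⟨ trans (∑∈-*ˡ R (ι 4)) (*-congˡ (∑∈-+ R)) ⟩
        ι 4 * (∑∈ R (λ x → ∑∈ R (λ y → w a x * w b y)) + ∑∈ R (λ x → ∑∈ R (λ y → w a y * w b x)))
          ≈⟨ *-congˡ (+-cong (∑∈-∑∈-* R R)
               (trans (∑∈-comm R R (λ x y → w a y * w b x)) (∑∈-∑∈-* R R))) ⟩
        ι 4 * (w[ a ] * w[ b ] + w[ a ] * w[ b ])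
          ≈⟨ solve 1 (λ x → :ι 4 :* (x :+ x) := :ι 8 :* x) refl (w[ a ] * w[ b ]) ⟩
        ι 8 * (w[ a ] * w[ b ])
          ∎

    W-splitʳ : ∀ {A X} Y → A ⊆ X → W I Y X ≈ W I Y A + W I Y (X ─ A)
    W-splitʳ {A} {X} Y A⊆X = begin-equality
      W I Y X                      ≈⟨ ∑∈-cong Y (λ {u} _ → ∑∈-split (w u) A⊆X) ⟩
      ∑∈ Y (λ u → ∑∈ A (w u) + ∑∈ (X ─ A) (w u)) ≈⟨ ∑∈-+ Y ⟩
      W I Y A + W I Y (X ─ A)      ∎

  -- The atoms inside a cluster

  module _ (I : Instance n) (𝒦 : List (Subset n)) where

    private
      _∖_ : List (Subset n) → Subset n → List (Subset n)
      _∖_ = _without_ I 𝒦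

    without-isPartitionOf : ∀ {X A 𝒫} → IsPartitionOf X 𝒫 → A ∈ₗ 𝒫 →
                            IsPartitionOf (X ─ A) (𝒫 ∖ A)
    without-isPartitionOf {X} {A} {𝒫} P A∈𝒫 = record
      { nonempty = All.filter⁺ ≢A? nonempty
      ; disjoint = AllPairs.filter⁺ ≢A? disjoint
      ; included = λ L∈ → let L∈𝒫 , L≢A = ∈ₗ.∈-filter⁻ ≢A? L∈ in
          ⊆-disjoint⇒⊆─ (included L∈𝒫)
            (λ x∈L x∈A → L≢A (AllPairs-Disjoint⇒≡ disjoint L∈𝒫 A∈𝒫 x∈L x∈A))
      ; covers   = λ u∈X─A → let L , L∈𝒫 , u∈L = find (covers (p─q⊆p X A u∈X─A)) in
          lose (∈ₗ.∈-filter⁺ ≢A? L∈𝒫 (λ L≡A → x∈p─q⇒x∉q X A u∈X─A (subst (_ ∈_) L≡A u∈L))) u∈L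
      }
      where
      open IsPartitionOf P
      ≢A? : ∀ L → Dec (L ≢ A)
      ≢A? L = ¬? (L ≟ₛ A)

    -- The atom of a vertex u of C lies in some cluster D because the clustering respects atoms. D
    -- and C share u, so D is C, and the atom lies in C.
    within-isPartitionOf : ∀ {𝒞 C} → IsPartition 𝒦 → IsPartition 𝒞 →
      (∀ {K} → K ∈ₗ 𝒦 → Any (K ⊆_) 𝒞) → C ∈ₗ 𝒞 → IsPartitionOf C (within I 𝒦 C)
    within-isPartitionOf {𝒞} {C} 𝒦-part 𝒞-part respecting C∈𝒞 = record
      { nonempty = All.filter⁺ (_⊆? C) 𝒦.nonempty
      ; disjoint = AllPairs.filter⁺ (_⊆? C) 𝒦.disjoint
      ; included = λ {K} K∈ → proj₂ (∈ₗ.∈-filter⁻ {P = _⊆ C} (_⊆? C) {K} {𝒦} K∈)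
      ; covers   = covers
      }
      where
      module 𝒦 = IsPartition 𝒦-part
      module 𝒞 = IsPartition 𝒞-part

      covers : ∀ {u} → u ∈ C → Any (u ∈_) (within I 𝒦 C)
      covers {u} u∈C with find (𝒦.covers u)
      ... | K , K∈𝒦 , u∈K with find (respecting K∈𝒦)
      ... | D , D∈𝒞 , K⊆D with AllPairs-Disjoint⇒≡ 𝒞.disjoint D∈𝒞 C∈𝒞 (K⊆D u∈K) u∈C
      ... | ≡.refl = lose (∈ₗ.∈-filter⁺ {P = _⊆ C} (_⊆? C) K∈𝒦 K⊆D) u∈K

    module _ (𝒦-part : IsPartition 𝒦) {C : Subset n}
             (C-atoms : IsPartitionOf C (within I 𝒦 C)) where
      open Instance I

      private
        -- `w⁺` is the integrand of `W⁺`. `ŵ` erases the weight inside atoms. Bounding the volume by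
        -- w(C,C) would be too crude: w(A,A) is not controlled by the weight from A to the rest of C
        -- when A has far more vertices than that rest.
        w⁺ ŵ : Fin n → Fin n → Carrier
        w⁺ u v = if does (v ∈? N⁺ u) then w u v else 0#
        ŵ u v = if does (together? 𝒦 u v) then 0# else w u v

      w⁺-nonneg : ∀ u v → 0# ≤ w⁺ u v
      w⁺-nonneg u v with does (v ∈? N⁺ u)
      ... | true  = w-nonneg u v
      ... | false = ≤-refl

      ŵ-nonneg : ∀ u v → 0# ≤ ŵ u v
      ŵ-nonneg u v with does (together? 𝒦 u v)
      ... | true  = ≤-refl
      ... | false = w-nonneg u v

      ŵ≤w : ∀ u v → ŵ u v ≤ w u v
      ŵ≤w u v with does (together? 𝒦 u v)
      ... | true  = w-nonneg u v
      ... | false = ≤-refl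

      ŵ-together : ∀ {A u v} → A ∈ₗ 𝒦 → u ∈ A → v ∈ A → ŵ u v ≈ 0#
      ŵ-together {u = u} {v} A∈𝒦 u∈A v∈A with together? 𝒦 u v
      ... | yes _   = refl
      ... | no ¬tog = contradiction (lose A∈𝒦 (u∈A , v∈A)) ¬tog

      -- An atom containing both u and v would equal K and L at once. So u and v are not together,
      -- and `ŵ u v` is the full weight.
      w⁺≤ŵ : ∀ {K L u v} → K ∈ₗ 𝒦 → L ∈ₗ 𝒦 → L ≢ K → u ∈ K → v ∈ L → w⁺ u v ≤ ŵ u v
      w⁺≤ŵ {u = u} {v} K∈𝒦 L∈𝒦 L≢K u∈K v∈L with together? 𝒦 u v | does (v ∈? N⁺ u)
      ... | no _    | true  = ≤-refl
      ... | no _    | false = w-nonneg u v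
      ... | yes tog | _     =
        let D , D∈𝒦 , u∈D , v∈D = find tog
            open IsPartition 𝒦-part
        in contradiction (≡.trans (AllPairs-Disjoint⇒≡ disjoint L∈𝒦 D∈𝒦 v∈L v∈D)
                                  (AllPairs-Disjoint⇒≡ disjoint D∈𝒦 K∈𝒦 u∈D u∈K)) L≢K

      Ŵ : Subset n → Subset n → Carrier
      Ŵ X Y = ∑∈ X (λ u → ∑∈ Y (ŵ u))

      Ŵ≤W : ∀ X Y → Ŵ X Y ≤ W I X Y
      Ŵ≤W X Y = ∑∈-mono-≤ X (λ {u} _ → ∑∈-mono-≤ Y (λ {v} _ → ŵ≤w u v))

      W⁺-nonneg : ∀ X Y → 0# ≤ W⁺ I X Y
      W⁺-nonneg X Y = ∑∈-nonneg (λ u → ∑∈-nonneg (w⁺-nonneg u) Y) X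

      d-nonneg : ∀ K → 0# ≤ d I 𝒦 C K
      d-nonneg K = ∑ₗ-nonneg (W⁺-nonneg K) (within I 𝒦 C ∖ K)

      -- Between different atoms `ŵ` dominates `w⁺`, and the atoms L are disjoint subsets of C, so
      -- their sums add up to at most the sum over C. `vol≤Ŵ` repeats the second argument in the
      -- first variable.
      d≤Ŵ : ∀ {K} → K ∈ₗ 𝒦 → d I 𝒦 C K ≤ Ŵ K C
      d≤Ŵ {K} K∈𝒦 = begin
        ∑ₗ Ls (W⁺ I K)                             ≤⟨ ∑ₗ-mono-≤ Ls (λ L∈ → W⁺≤Ŵ L∈) ⟩
        ∑ₗ Ls (λ L → ∑∈ K (λ u → ∑∈ L (ŵ u)))      ≈⟨ ∑∈-∑ₗ K Ls (λ L u → ∑∈ L (ŵ u)) ⟩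
        ∑∈ K (λ u → ∑ₗ Ls (λ L → ∑∈ L (ŵ u)))
          ≤⟨ ∑∈-mono-≤ K (λ {u} _ → ∑ₗ-disjoint-≤ (ŵ-nonneg u)
               (AllPairs.filter⁺ ≢K? disjoint) (All.filter⁺ ≢K? (All.all-filter (_⊆? C) 𝒦))) ⟩
        Ŵ K C                                      ∎
        where
        open IsPartitionOf C-atoms
        ≢K? : ∀ L → Dec (L ≢ K)
        ≢K? L = ¬? (L ≟ₛ K)
        Ls = within I 𝒦 C ∖ K

        W⁺≤Ŵ : ∀ {L} → L ∈ₗ Ls → W⁺ I K L ≤ Ŵ K L
        W⁺≤Ŵ {L} L∈ with ∈ₗ.∈-filter⁻ ≢K? {xs = within I 𝒦 C} L∈
        ... | L∈C , L≢K with ∈ₗ.∈-filter⁻ {P = _⊆ C} (_⊆? C) {L} {𝒦} L∈C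
        ... | L∈𝒦 , _ =
          ∑∈-mono-≤ K (λ u∈K → ∑∈-mono-≤ L (λ v∈L → w⁺≤ŵ K∈𝒦 L∈𝒦 L≢K u∈K v∈L))

      vol≤Ŵ : vol I 𝒦 C ≤ Ŵ C C
      vol≤Ŵ = begin
        ∑ₗ (within I 𝒦 C) (d I 𝒦 C)       ≤⟨ ∑ₗ-mono-≤ (within I 𝒦 C) (λ {K} K∈ →
          d≤Ŵ (proj₁ (∈ₗ.∈-filter⁻ {P = _⊆ C} (_⊆? C) {K} {𝒦} K∈))) ⟩
        ∑ₗ (within I 𝒦 C) (λ K → Ŵ K C)  ≤⟨ ∑ₗ-disjoint-≤ (λ u → ∑∈-nonneg (ŵ-nonneg u) C)
                                               disjoint (All.all-filter (_⊆? C) 𝒦) ⟩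
        Ŵ C C                             ∎
        where open IsPartitionOf C-atoms

      -- The part `Ŵ A A` vanishes because A is a single atom; this is the purpose of `ŵ`.
      Ŵ≤W-─ : ∀ {A} → A ∈ₗ 𝒦 → A ⊆ C → Ŵ A C ≤ W I A (C ─ A)
      Ŵ≤W-─ {A} A∈𝒦 A⊆C = begin
        Ŵ A C
          ≈⟨ ∑∈-cong A (λ {u} _ → ∑∈-split (ŵ u) A⊆C) ⟩
        ∑∈ A (λ u → ∑∈ A (ŵ u) + ∑∈ (C ─ A) (ŵ u))
          ≈⟨ ∑∈-cong A (λ u∈A → trans (+-congʳ (trans (∑∈-cong A (ŵ-together A∈𝒦 u∈A)) (∑∈-zero A)))
                                       (+-identityˡ _)) ⟩
        Ŵ A (C ─ A)
          ≤⟨ Ŵ≤W A (C ─ A) ⟩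
        W I A (C ─ A) ∎

      module _ {A : Subset n} (A∈𝒦 : A ∈ₗ 𝒦) (A⊆C : A ⊆ C) where

        private
          A∈C : A ∈ₗ within I 𝒦 C
          A∈C = ∈ₗ.∈-filter⁺ {P = _⊆ C} (_⊆? C) A∈𝒦 A⊆C

          rest-atoms : IsPartitionOf (C ─ A) (within I 𝒦 C ∖ A)
          rest-atoms = without-isPartitionOf C-atoms A∈C

        -- Makes `C ─ A` admissible as the side T in (R1).
        rest-unionOf : UnionOf 𝒦 (C ─ A)
        rest-unionOf = within I 𝒦 C ∖ A
                     , All.filter⁺ _ (All.filter⁺ (_⊆? C) (All.tabulate λ K∈𝒦 → K∈𝒦))
                     , ⋃-≡ rest-atoms

        -- `C ─ A` is the union of the other atoms of C, over which `d` sums. This direction carries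
        -- the lower bound of (R1) over to `d`.
        W⁺≤d : W⁺ I A (C ─ A) ≤ d I 𝒦 C A
        W⁺≤d = begin
          W⁺ I A (C ─ A)
            ≡⟨ ≡.cong (W⁺ I A) (⋃-≡ rest-atoms) ⟩
          ∑∈ A (λ u → ∑∈ (⋃ Ls) (w⁺ u))
            ≤⟨ ∑∈-mono-≤ A (λ {u} _ → ∑∈-⋃-≤ (w⁺-nonneg u) Ls) ⟩
          ∑∈ A (λ u → ∑ₗ Ls (λ L → ∑∈ L (w⁺ u)))
            ≈⟨ ∑∈-∑ₗ A Ls (λ L u → ∑∈ L (w⁺ u)) ⟨
          d I 𝒦 C A ∎
          where Ls = within I 𝒦 C ∖ A

        d≤vol : d I 𝒦 C A ≤ vol I 𝒦 C
        d≤vol = ∈⇒≤∑ₗ d-nonneg A∈C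

      -- Consequences of (R1)

      module _ (R1 : ∀ {S T} → UnionOf 𝒦 S → UnionOf 𝒦 T → Nonempty S → Nonempty T →
                     S ∪ T ≡ C → Empty (S ∩ T) → (1# / ι 2) * W I S T < W⁺ I S T) where

        -- B is there to supply a vertex of `C ─ A`, since (R1) requires both sides to be nonempty.
        halfW<d : ∀ {A B} → A ∈ₗ 𝒦 → B ∈ₗ 𝒦 → A ⊆ C → B ⊆ C → A ≢ B →
                  (1# / ι 2) * W I A (C ─ A) < d I 𝒦 C A
        halfW<d {A} {B} A∈𝒦 B∈𝒦 A⊆C B⊆C A≢B = <-≤-trans
          (R1 (A ∷ [] , A∈𝒦 ∷ [] , ≡.sym (∪-identityʳ A)) (rest-unionOf A∈𝒦 A⊆C)
              (All.lookup nonempty A∈𝒦)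
              (let b , b∈B = All.lookup nonempty B∈𝒦 in
               b , x∈p∧x∉q⇒x∈p─q (B⊆C b∈B)
                     (λ b∈A → A≢B (AllPairs-Disjoint⇒≡ disjoint A∈𝒦 B∈𝒦 b∈A b∈B)))
              (∪-─-cancel A⊆C)
              (λ (x , x∈) → let x∈A , x∈C─A = x∈p∩q⁻ A (C ─ A) x∈ in
                x∈p─q⇒x∉q C A x∈C─A x∈A))
          (W⁺≤d A∈𝒦 A⊆C)
          where open IsPartition 𝒦-part

        W<2d : ∀ {A B} → A ∈ₗ 𝒦 → B ∈ₗ 𝒦 → A ⊆ C → B ⊆ C → A ≢ B →
               W I A (C ─ A) < ι 2 * d I 𝒦 C A
        W<2d A∈𝒦 B∈𝒦 A⊆C B⊆C A≢B =
          [1/z]*x<y⇒x<z*y (0<ι1+k 1) (halfW<d A∈𝒦 B∈𝒦 A⊆C B⊆C A≢B)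

        module _ {A B : Subset n} (A∈𝒦 : A ∈ₗ 𝒦) (B∈𝒦 : B ∈ₗ 𝒦) (A⊆C : A ⊆ C) (B⊆C : B ⊆ C)
                 (A≢B : A ≢ B) where

          private
            -- As an iterated difference, R is what remains when C is split first at A and then at
            -- B. The opposite order, needed in `W-B`, costs one exchange of the two differences.
            R : Subset n
            R = C ─ A ─ B

            AB AR BR RR dA dB : Carrier
            AB = W I A B
            AR = W I A R
            BR = W I B R
            RR = W I R R
            dA = d I 𝒦 C A
            dB = d I 𝒦 C B

            A#B : ∀ {x} → x ∈ A → x ∉ B
            A#B x∈A x∈B = A≢B (AllPairs-Disjoint⇒≡ (IsPartition.disjoint 𝒦-part) A∈𝒦 B∈𝒦 x∈A x∈B)

            A⊆C─B : A ⊆ C ─ B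
            A⊆C─B = ⊆-disjoint⇒⊆─ A⊆C A#B

            B⊆C─A : B ⊆ C ─ A
            B⊆C─A = ⊆-disjoint⇒⊆─ B⊆C (λ x∈B x∈A → A#B x∈A x∈B)

            W-A : W I A (C ─ A) ≈ AB + AR
            W-A = W-splitʳ I A B⊆C─A

            W-B : W I B (C ─ B) ≈ AB + BR
            W-B = begin-equality
              W I B (C ─ B)            ≈⟨ W-splitʳ I B A⊆C─B ⟩
              W I B A + W I B (C ─ B ─ A)
                ≈⟨ +-cong (W-sym I B A) (reflexive (≡.cong (W I B) (p─q─r≡p─r─q C B A))) ⟩
              AB + BR                  ∎

            W-R : W I R C ≈ AR + (BR + RR)
            W-R = begin-equality
              W I R C                            ≈⟨ W-splitʳ I R A⊆C ⟩
              W I R A + W I R (C ─ A)            ≈⟨ +-congˡ (W-splitʳ I R B⊆C─A) ⟩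
              W I R A + (W I R B + W I R R)      ≈⟨ +-cong (W-sym I R A) (+-congʳ (W-sym I R B)) ⟩
              AR + (BR + RR)                     ∎

          -- In the rows of A and B the weight inside the atom has to be dropped. In the row of R it
          -- may stay, because `W-quadrilateral` controls all of w(R,R), including pairs inside one
          -- atom.
          vol≤ : vol I 𝒦 C ≤ (AB + AR) + ((AB + BR) + (AR + (BR + RR)))
          vol≤ = begin
            vol I 𝒦 C                            ≤⟨ vol≤Ŵ ⟩
            Ŵ C C                                ≈⟨ ∑∈-split _ A⊆C ⟩
            Ŵ A C + Ŵ (C ─ A) C                  ≈⟨ +-congˡ (∑∈-split _ B⊆C─A) ⟩
            Ŵ A C + (Ŵ B C + Ŵ R C)
              ≤⟨ +-mono-≤ (Ŵ≤W-─ A∈𝒦 A⊆C) (+-mono-≤ (Ŵ≤W-─ B∈𝒦 B⊆C) (Ŵ≤W R C)) ⟩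
            W I A (C ─ A) + (W I B (C ─ B) + W I R C)
              ≈⟨ +-cong W-A (+-cong W-B W-R) ⟩
            (AB + AR) + ((AB + BR) + (AR + (BR + RR))) ∎

          W*vol≤ : AB * vol I 𝒦 C ≤ ι 8 * (W I A (C ─ A) * W I B (C ─ B))
          W*vol≤ = begin
            AB * vol I 𝒦 C
              ≤⟨ *-monoˡ-≤-nonneg AB (W-nonneg I A B) vol≤ ⟩
            AB * ((AB + AR) + ((AB + BR) + (AR + (BR + RR))))
              ≈⟨ solve 4 (λ ab ar br rr →
                   ab :* ((ab :+ ar) :+ ((ab :+ br) :+ (ar :+ (br :+ rr)))) :=
                   :ι 2 :* (ab :* ((ab :+ ar) :+ br)) :+ ab :* rr) refl AB AR BR RR ⟩
            ι 2 * (AB * ((AB + AR) + BR)) + AB * RR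
              ≤⟨ +-monoʳ-≤ _ (W-quadrilateral I A B R) ⟩
            ι 2 * (AB * ((AB + AR) + BR)) + ι 8 * (AR * BR)
              -- The target exceeds 8 w(A,R) w(B,R) by 8 w(A,B) (w(A,B) + w(A,R) + w(B,R)). Two of
              -- these eight copies are present; the other six are slack.
              ≤⟨ x≤x+y (*-nonneg (0≤ι 6) (*-nonneg (W-nonneg I A B)
                   (+-nonneg (+-nonneg (W-nonneg I A B) (W-nonneg I A R)) (W-nonneg I B R)))) ⟩
            ι 2 * (AB * ((AB + AR) + BR)) + ι 8 * (AR * BR) + ι 6 * (AB * ((AB + AR) + BR))
              ≈⟨ solve 3 (λ ab ar br →
                   :ι 2 :* (ab :* ((ab :+ ar) :+ br)) :+ :ι 8 :* (ar :* br)
                     :+ :ι 6 :* (ab :* ((ab :+ ar) :+ br)) :=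
                   :ι 8 :* ((ab :+ ar) :* (ab :+ br))) refl AB AR BR ⟩
            ι 8 * ((AB + AR) * (AB + BR))
              ≈⟨ *-congˡ (*-cong W-A W-B) ⟨
            ι 8 * (W I A (C ─ A) * W I B (C ─ B)) ∎

          W*vol< : AB * vol I 𝒦 C < ι 32 * (dA * dB)
          W*vol< = begin-strict
            AB * vol I 𝒦 C
              ≤⟨ W*vol≤ ⟩
            ι 8 * (W I A (C ─ A) * W I B (C ─ B))
              <⟨ *-monoˡ-<-pos (ι 8) (0<ι1+k 7)
                   (*-mono-<-nonneg (W-nonneg I A (C ─ A)) (W-nonneg I B (C ─ B))
                     (W<2d A∈𝒦 B∈𝒦 A⊆C B⊆C A≢B)
                     (W<2d B∈𝒦 A∈𝒦 B⊆C A⊆C (λ B≡A → A≢B (≡.sym B≡A)))) ⟩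
            ι 8 * ((ι 2 * dA) * (ι 2 * dB))
              ≈⟨ solve 2 (λ a b → :ι 8 :* ((:ι 2 :* a) :* (:ι 2 :* b)) := :ι 32 :* (a :* b))
                   refl dA dB ⟩
            ι 32 * (dA * dB) ∎

          -- Needed for the division, as the inverse of zero is unspecified. (R1) puts `dA` strictly
          -- above a nonnegative number, and `dA` is one summand of the volume.
          0<vol : 0# < vol I 𝒦 C
          0<vol = begin-strict
            0#
              ≤⟨ *-nonneg (*-nonneg (inj₁ 0<1) (inj₁ (⁻¹-pos (0<ι1+k 1)))) (W-nonneg I A (C ─ A)) ⟩
            (1# / ι 2) * W I A (C ─ A)
              <⟨ halfW<d A∈𝒦 B∈𝒦 A⊆C B⊆C A≢B ⟩
            dA
              ≤⟨ d≤vol A∈𝒦 A⊆C ⟩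
            vol I 𝒦 C                    ∎

          W<32dd/vol : AB < ι 32 * ((dA * dB) / vol I 𝒦 C)
          W<32dd/vol = <-respʳ-≈ (*-assoc (ι 32) (dA * dB) (vol I 𝒦 C ⁻¹))
            (x*z<y⇒x<y/z 0<vol W*vol<)

claim3p7 : {c ℓ₁ ℓ₂ : Level} (F : OrderedField c ℓ₁ ℓ₂) →
  let open OrderedField F
      open CorrelationClustering F
  in
  (√7 : Carrier) → 0# ≤ √7 → √7 * √7 ≈ ι 7 →
  (β : Carrier) → 0# < β → β ≤ (ι 2 * √7 - ι 5) / ι 6 →
  (α : Carrier) → 1# ≤ α → IsAtomConstant β α →
  (ε : Carrier) → 0# < ε → ε ≤ 1# →
  (n : ℕ) → 2 ℕ.≤ n → (I : Instance n) →
  (opt : Carrier) → IsOPT I opt →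
  (𝒞⁰ : List (Subset n)) → IsPartition 𝒞⁰ → obj I 𝒞⁰ ≤ (ι 20 / ι 3) * opt →
  let 𝒦 = atoms I β 𝒞⁰ in
  (𝒞₁ : List (Subset n)) → IsRegular I 𝒦 opt ε α 𝒞₁ →
  (C : Subset n) → C ∈ₗ 𝒞₁ → 2 ℕ.≤ length (within I 𝒦 C) →
  (A B : Subset n) → A ∈ₗ 𝒦 → B ∈ₗ 𝒦 → A ⊆ C → B ⊆ C → ¬ (A ≡ B) →
  W I A B < ι 32 * ((d I 𝒦 C A * d I 𝒦 C B) / vol I 𝒦 C)
claim3p7 F _ _ _ β _ _ _ _ _ _ _ _ _ _ I _ _ _ 𝒞⁰-part _ _ regular _ C∈𝒞₁ _ _ _
         A∈𝒦 B∈𝒦 A⊆C B⊆C A≢B =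
  W<32dd/vol F I _ 𝒦-part
    (within-isPartitionOf F I _ 𝒦-part isPartition respecting C∈𝒞₁)
    (R1 C∈𝒞₁) A∈𝒦 B∈𝒦 A⊆C B⊆C A≢B
  where
  open CorrelationClustering F
  open IsRegular regular
  𝒦-part = atoms-isPartition F I β 𝒞⁰-part
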